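{- Let $G=K_{m_1,\ldots,m_k}$ be a complete multipartite graph with $k\ge 2$, $1\le m_1\le m_2\le\cdots\le m_k$ and $m_k\ge 2$, and let $V$ be its vertex set. Let $\lambda:=|\{i\mid m_i\ge 2\}|$. If $\lambda\ge 2$, then $\operatorname{nim}(\mathrm{DNT}(G))=\operatorname{pty}(V)$.
   Context: For a graph $G$ with vertex set $V$, a set $K\subseteq V$ is convex if it contains every vertex lying on any shortest path between two elements of $K$. The convex hull $[P]$ of $P\subseteq V$ is the smallest convex set containing $P$. For a finite set $A$, $\operatorname{pty}(A):=|A|\bmod 2\in\{0,1\}$. The game $\mathrm{DNT}(G)$: positions are the sets $P\subseteq V$ with $[V\setminus P]=V$; the starting position is $\emptyset$; the options of $P$ are the sets $P\cup\{v\}$ with $v\in V\setminus P$ and $[V\setminus(P\cup\{v\})]=V$. The nim-value of a position is defined recursively by $\operatorname{nim}(p)=\operatorname{mex}\{\operatorname{nim}(q): q\text{ an option of }p\}$, where $\operatorname{mex}(A)$ is the smallest nonnegative integer not in $A$; the nim-value of a game is that of its starting position. -}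

module Defs where

open import Data.Bool.Base using (true)
import Data.Bool.Properties as Bool
open import Data.Fin.Base using (Fin; zero; suc; splitAt)
import Data.Fin.Properties as Fin
open import Data.Fin.Subset using (Subset; _∈_; _∉_; _⊆_; _⊃_; ∁; _∪_; ⁅_⁆; ⊤; ∣_∣) renaming (⊥ to ∅)
open import Data.Fin.Subset.Induction using (⊃-wellFounded)
open import Data.Fin.Subset.Properties using (_∈?_; _⊆?_; anySubset?; ⊆-antisym; ⊆-max; p⊆p∪q; q⊆p∪q; x∈⁅x⁆; x∉p⇒x∈∁p; ∉⊥)
open import Data.List.Base using (List; []; _∷_; map; mapMaybe; allFin)
import Data.List.Extrema.Nat as Extrema
import Data.List.Membership.DecPropositional as DecMembership
open import Data.List.Membership.Propositional using (mapWith∈) renaming (_∈_ to _∈ˡ_; _∉_ to _∉ˡ_)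
open import Data.List.Membership.Propositional.Properties using (mapWith∈-cong; mapWith∈≗map)
import Data.List.Relation.Unary.All as All
open import Data.List.Relation.Unary.Any using (here; there)
open import Data.Maybe.Base as Maybe using (Maybe; just; nothing)
open import Data.Nat.Base using (ℕ; zero; suc; _+_; _≤_; _<_; _%_)
import Data.Nat.Properties as ℕ
open import Data.Product.Base using (Σ; ∃; ∃-syntax; _×_; _,_; proj₁; proj₂)
open import Data.Sum.Base using ([_,_]′)
open import Data.Vec.Base using (Vec; []; _∷_; head; last; lookup; tabulate; sum)
open import Data.Vec.Properties using (lookup∘tabulate; lookup⇒[]=; []=⇒lookup; ≡-dec)
open import Data.Vec.Membership.Propositional using () renaming (_∈_ to _∈ᵛ_)
import Data.Vec.Membership.DecPropositional as DecVecMembership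
open import Data.Vec.Relation.Unary.Linked using (Linked; linked?)
open import Data.Vec.Relation.Unary.Unique.Propositional using (Unique)
open import Data.Vec.Relation.Unary.Unique.Propositional.Properties using (lookup-injective)
import Data.Vec.Relation.Unary.AllPairs as AllPairs
open import Function.Base using (_∘_; const)
open import Induction.WellFounded using (WellFounded; module All; module FixPoint; module Subrelation)
open import Level using (0ℓ)
import Relation.Binary.Construct.On as On
open import Relation.Binary.Core using (Rel)
open import Relation.Binary.Definitions using (Symmetric; Irreflexive) renaming (Decidable to Decidable₂)
open import Relation.Binary.PropositionalEquality using (_≡_; _≢_; refl; sym; trans; cong; subst; ≢-sym)
open import Relation.Nullary.Decidable using (Dec; yes; no; does; map′; ¬?; _×-dec_; _→-dec_; dec⇒maybe; decidable-stable; dec-true)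
open import Relation.Unary using (Decidable)

------------------------------------------------------------------------
-- Finite simple graphs and geodesic convexity

record Graph (n : ℕ) : Set₁ where
  field
    Adj        : Rel (Fin n) 0ℓ
    adj?       : Decidable₂ Adj
    adj-sym    : Symmetric Adj
    adj-irrefl : Irreflexive _≡_ Adj

anyVec? : ∀ {n} m {P : Vec (Fin n) m → Set} → Decidable P → Dec (∃ P)
anyVec? zero    P? = map′ ([] ,_) (λ { ([] , p) → p }) (P? [])
anyVec? (suc m) P? =
  map′ (λ { (x , xs , p) → x ∷ xs , p }) (λ { (x ∷ xs , p) → x , xs , p })
       (Fin.any? (λ x → anyVec? m (λ xs → P? (x ∷ xs))))

allVec? : ∀ {n} m {P : Vec (Fin n) m → Set} → Decidable P → Dec (∀ p → P p)
allVec? m P? =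
  map′ (λ ¬∃ p → decidable-stable (P? p) (λ ¬Pp → ¬∃ (p , ¬Pp)))
       (λ { ∀P (p , ¬Pp) → ¬Pp (∀P p) })
       (¬? (anyVec? m (¬? ∘ P?)))

allSubset? : ∀ {n} {P : Subset n → Set} → Decidable P → Dec (∀ p → P p)
allSubset? P? =
  map′ (λ ¬∃ p → decidable-stable (P? p) (λ ¬Pp → ¬∃ (p , ¬Pp)))
       (λ { ∀P (p , ¬Pp) → ¬Pp (∀P p) })
       (¬? (anySubset? (¬? ∘ P?)))

module _ {n : ℕ} (G : Graph n) where
  open Graph G using (Adj; adj?)

  -- A path with ℓ edges is recorded by its suc ℓ vertices.
  IsPath : ∀ {ℓ} → Fin n → Fin n → Vec (Fin n) (suc ℓ) → Set
  IsPath u v p = head p ≡ u × last p ≡ v × Linked Adj p × Unique p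

  IsShortestPath : ∀ {ℓ} → Fin n → Fin n → Vec (Fin n) (suc ℓ) → Set
  IsShortestPath {ℓ} u v p =
    IsPath u v p × (∀ {m} (q : Vec (Fin n) (suc m)) → IsPath u v q → ℓ ≤ m)

  Convex : Subset n → Set
  Convex K = ∀ {u v} → u ∈ K → v ∈ K →
    ∀ {ℓ} (p : Vec (Fin n) (suc ℓ)) → IsShortestPath u v p →
    ∀ w → w ∈ᵛ p → w ∈ K

  InHull : Subset n → Fin n → Set
  InHull P v = ∀ K → Convex K → P ⊆ K → v ∈ K

  isPath? : ∀ {ℓ} u v → Decidable (IsPath {ℓ} u v)
  isPath? u v p =
    (head p Fin.≟ u) ×-dec (last p Fin.≟ v) ×-dec
    linked? adj? p ×-dec AllPairs.allPairs? (λ x y → ¬? (x Fin.≟ y)) p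

  path-length< : ∀ {ℓ u v} {p : Vec (Fin n) (suc ℓ)} → IsPath u v p → ℓ < n
  path-length< {p = p} (_ , _ , _ , unique) =
    Fin.injective⇒≤ {f = lookup p} (λ {i} {j} → lookup-injective unique i j)

  isShortestPath? : ∀ {ℓ} u v → Decidable (IsShortestPath {ℓ} u v)
  isShortestPath? {ℓ} u v p =
    isPath? u v p ×-dec
    map′ (λ noShorter {m} q q-path → ℕ.≮⇒≥ (λ m<ℓ → noShorter m<ℓ q q-path))
         (λ shortest {m} m<ℓ q q-path → ℕ.<⇒≱ m<ℓ (shortest q q-path))
         (ℕ.allUpTo? (λ m → allVec? (suc m) (¬? ∘ isPath? u v)) ℓ)

  convex? : Decidable Convex
  convex? K =
    map′ (λ f {u} {v} u∈K v∈K {ℓ} p sp → f u v u∈K v∈K {ℓ} (path-length< (proj₁ sp)) p sp)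
         (λ f u v u∈K v∈K {ℓ} _ → f u∈K v∈K {ℓ})
         (Fin.all? λ u → Fin.all? λ v → (u ∈? K) →-dec ((v ∈? K) →-dec
           ℕ.allUpTo? (shortestPathsInside? u v) n))
    where
    open DecVecMembership Fin._≟_ using () renaming (_∈?_ to _∈ᵛ?_)

    ShortestPathsInside : Fin n → Fin n → ℕ → Set
    ShortestPathsInside u v ℓ =
      ∀ (p : Vec (Fin n) (suc ℓ)) → IsShortestPath u v p → ∀ w → w ∈ᵛ p → w ∈ K

    shortestPathsInside? : ∀ u v → Decidable (ShortestPathsInside u v)
    shortestPathsInside? u v ℓ = allVec? (suc ℓ) λ p →
      isShortestPath? u v p →-dec Fin.all? λ w → (w ∈ᵛ? p) →-dec (w ∈? K)

  -- Opaque because unfolding this search makes type checking intractable;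
  -- does (inHull? P v) is determined by InHull P v alone.
  opaque
    inHull? : ∀ P → Decidable (InHull P)
    inHull? P v = allSubset? λ K → convex? K →-dec (P ⊆? K) →-dec (v ∈? K)

  -- The intersection of all convex sets containing P; it is the smallest
  -- one by hull-convex, hull-extensive and hull-least.
  hull : Subset n → Subset n
  hull P = tabulate (does ∘ inHull? P)

  ∈-hull⁺ : ∀ {P v} → InHull P v → v ∈ hull P
  ∈-hull⁺ {P} {v} h = lookup⇒[]= v _
    (trans (lookup∘tabulate (does ∘ inHull? P) v) (dec-true (inHull? P v) h))

  ∈-hull⁻ : ∀ {P v} → v ∈ hull P → InHull P v
  ∈-hull⁻ {P} {v} v∈ = holds (inHull? P v)
    (trans (sym (lookup∘tabulate (does ∘ inHull? P) v)) ([]=⇒lookup v∈))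
    where
    holds : ∀ {A : Set} (a? : Dec A) → does a? ≡ true → A
    holds (yes a) _ = a

  hull-convex : ∀ P → Convex (hull P)
  hull-convex P u∈ v∈ p sp w w∈p = ∈-hull⁺ λ K conv P⊆K →
    conv (∈-hull⁻ u∈ K conv P⊆K) (∈-hull⁻ v∈ K conv P⊆K) p sp w w∈p

  hull-extensive : ∀ P → P ⊆ hull P
  hull-extensive P x∈P = ∈-hull⁺ λ K _ P⊆K → P⊆K x∈P

  hull-least : ∀ P K → Convex K → P ⊆ K → hull P ⊆ K
  hull-least P K conv P⊆K v∈ = ∈-hull⁻ v∈ K conv P⊆K

------------------------------------------------------------------------
-- Impartial games and nim-values

open DecMembership ℕ._≟_ using () renaming (_∈?_ to _∈ˡ?_)

-- Search upwards from k, knowing that some b = k + f is not in the list.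
leastFrom : ∀ xs k f → k + f ∉ˡ xs → (∀ {j} → j < k → j ∈ˡ xs) →
            ∃[ m ] (m ∉ˡ xs × (∀ {j} → j < m → j ∈ˡ xs))
leastFrom xs k zero    k+f∉ below = k , subst (_∉ˡ xs) (ℕ.+-identityʳ k) k+f∉ , below
leastFrom xs k (suc f) k+f∉ below with k ∈ˡ? xs
... | no  k∉ = k , k∉ , below
... | yes k∈ = leastFrom xs (suc k) f (subst (_∉ˡ xs) (ℕ.+-suc k f) k+f∉) below′
  where
  below′ : ∀ {j} → j < suc k → j ∈ˡ xs
  below′ {j} j<1+k with j ℕ.≟ k
  ... | yes refl = k∈
  ... | no  j≢k  = below (ℕ.≤∧≢⇒< (ℕ.≤-pred j<1+k) j≢k)

leastMissing : ∀ xs → ∃[ m ] (m ∉ˡ xs × (∀ {j} → j < m → j ∈ˡ xs))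
leastMissing xs = leastFrom xs 0 (suc (Extrema.max 0 xs))
  (λ ∈xs → ℕ.<-irrefl refl (All.lookup (Extrema.xs≤max 0 xs) ∈xs)) (λ ())

mex : List ℕ → ℕ
mex xs = proj₁ (leastMissing xs)

record ImpartialGame : Set₁ where
  field
    Position    : Set
    start       : Position
    options     : Position → List Position
    wellFounded : WellFounded (λ q p → q ∈ˡ options p)

module _ (𝒢 : ImpartialGame) where
  open ImpartialGame 𝒢

  step : ∀ p → (∀ {q} → q ∈ˡ options p → ℕ) → ℕ
  step p rec = mex (mapWith∈ (options p) rec)

  -- The recursion of step is unrolled by nimAt-mex.
  nimAt : Position → ℕ
  nimAt = All.wfRec wellFounded 0ℓ (λ _ → ℕ) step

  nimAt-mex : ∀ p → nimAt p ≡ mex (map nimAt (options p))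
  nimAt-mex p = trans
    (FixPoint.unfold-wfRec wellFounded (λ _ → ℕ) step
      (λ q eq → cong mex (mapWith∈-cong (options q) _ _ eq)) {p})
    (cong mex (mapWith∈≗map nimAt (options p)))

  nim : ℕ
  nim = nimAt start

------------------------------------------------------------------------
-- The game DNT(G)

∈-mapMaybe⁻ : ∀ {A B : Set} (f : A → Maybe B) xs {y} →
              y ∈ˡ mapMaybe f xs → ∃[ x ] f x ≡ just y
∈-mapMaybe⁻ f (x ∷ xs) y∈ with f x in eq
∈-mapMaybe⁻ f (x ∷ xs) y∈          | nothing = ∈-mapMaybe⁻ f xs y∈
∈-mapMaybe⁻ f (x ∷ xs) (here refl) | just _  = x , eq
∈-mapMaybe⁻ f (x ∷ xs) (there y∈)  | just _  = ∈-mapMaybe⁻ f xs y∈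

map-dec⇒maybe⁻ : ∀ {A B : Set} (f : A → B) (a? : Dec A) {b} →
                 Maybe.map f (dec⇒maybe a?) ≡ just b → ∃[ a ] f a ≡ b
map-dec⇒maybe⁻ f (yes a) refl = a , refl

module _ {n : ℕ} (G : Graph n) where

  DNTPosition : Set
  DNTPosition = Σ (Subset n) λ P → hull G (∁ P) ≡ ⊤

  move? : (P : Subset n) → ∀ v → Dec (v ∉ P × hull G (∁ (P ∪ ⁅ v ⁆)) ≡ ⊤)
  move? P v = ¬? (v ∈? P) ×-dec ≡-dec Bool._≟_ (hull G (∁ (P ∪ ⁅ v ⁆))) ⊤

  position : ∀ P v → v ∉ P × hull G (∁ (P ∪ ⁅ v ⁆)) ≡ ⊤ → DNTPosition
  position P v (_ , h) = P ∪ ⁅ v ⁆ , h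

  move : (P : Subset n) → Fin n → Maybe DNTPosition
  move P v = Maybe.map (position P v) (dec⇒maybe (move? P v))

  ∈-moves⇒⊃ : ∀ P vs {Q} → Q ∈ˡ mapMaybe (move P) vs → proj₁ Q ⊃ P
  ∈-moves⇒⊃ P vs Q∈ with ∈-mapMaybe⁻ (move P) vs Q∈
  ... | v , eq with map-dec⇒maybe⁻ (position P v) (move? P v) eq
  ...   | (v∉P , h) , refl = p⊆p∪q ⁅ v ⁆ , v , q⊆p∪q P ⁅ v ⁆ (x∈⁅x⁆ v) , v∉P

  DNT : ImpartialGame
  DNT = record
    { Position    = DNTPosition
    ; start       = ∅ , ⊆-antisym (⊆-max _)
                      (λ _ → hull-extensive G (∁ ∅) (x∉p⇒x∈∁p ∉⊥))
    ; options     = λ (P , _) → mapMaybe (move P) (allFin n)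
    ; wellFounded = Subrelation.wellFounded (λ {_} {P} → ∈-moves⇒⊃ (proj₁ P) (allFin n))
                      (On.wellFounded proj₁ ⊃-wellFounded)
    }

------------------------------------------------------------------------
-- Complete multipartite graphs

-- Fin (sum m) is cut into consecutive blocks of sizes m₁, …, mₖ.
part : ∀ {k} (m : Vec ℕ k) → Fin (sum m) → Fin k
part (m₁ ∷ m) v = [ const zero , suc ∘ part m ]′ (splitAt m₁ v)

completeMultipartite : ∀ {k} (m : Vec ℕ k) → Graph (sum m)
completeMultipartite m = record
  { Adj        = λ u v → part m u ≢ part m v
  ; adj?       = λ u v → ¬? (part m u Fin.≟ part m v)
  ; adj-sym    = ≢-sym
  ; adj-irrefl = λ { refl u≢u → u≢u refl }
  }

pty : ∀ {n} → Subset n → ℕ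
pty A = ∣ A ∣ % 2

{-# OPTIONS --safe #-}

-- In a complete multipartite graph two distinct vertices of one part are at
-- distance 2, so their hull contains every other part; as another part also has
-- two vertices, the hull is everything. A set meeting each part at most once is a
-- clique, hence convex. So the complement of a position is exactly a set containing
-- two vertices of one part, and a move is available as long as this complement has
-- at least three elements. Every play therefore has |V| − 2 moves, and the nim-value
-- of P is the parity of |V \ P|.

module Submission where

open import Defs
open import Data.Nat.Base using (ℕ; suc; _≤_)
open import Data.Nat.Properties using (_≤?_)
open import Data.Vec.Base using (Vec; last; sum; count)
open import Data.Vec.Relation.Unary.All using (All)
open import Data.Vec.Relation.Unary.Linked using (Linked)
open import Data.Fin.Subset using (⊤)
open import Relation.Binary.PropositionalEquality using (_≡_)

open import Data.Fin.Base using (Fin; zero; suc; _↑ˡ_; _↑ʳ_)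
import Data.Fin.Properties as Fin
open import Data.Fin.Subset using (Subset; inside; outside; _∈_; _∉_; _⊆_; ∁; _∪_; ⁅_⁆; ∣_∣) renaming (⊥ to ∅)
open import Data.Fin.Subset.Properties
  using (_∈?_; ∈⊤; ∉⊥; p⊆p∪q; q⊆p∪q; ⊆-antisym; ⊆-max; ∪-identityʳ; x∈p∪q⁻; x∈⁅x⁆; x∈⁅y⁆⇒x≡y;
         x∈∁p⇒x∉p; x∉p⇒x∈∁p; x∈p⇒x∉∁p; ∣⊥∣≡0)
open import Data.List.Base using (List; map; allFin)
open import Data.List.Membership.Propositional using () renaming (_∈_ to _∈ˡ_; _∉_ to _∉ˡ_)
open import Data.List.Membership.Propositional.Properties using (∈-map⁺; ∈-map⁻; ∈-allFin)
import Data.List.Relation.Unary.Any as Any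
import Data.List.Relation.Unary.Any.Properties as Any
open import Data.Maybe.Base using (just)
import Data.Maybe.Relation.Unary.Any as MAny
open import Data.Nat.Base using (zero; _<_; _∸_; _%_; z≤n; s≤s)
import Data.Nat.Properties as ℕ
open import Data.Product.Base using (∃-syntax; _×_; _,_; proj₁; proj₂; map₂)
open import Data.Sum.Base using (_⊎_; inj₁; inj₂; [_,_])
open import Data.Vec.Base using ([]; _∷_; lookup; here; there)
import Data.Vec.Relation.Unary.Any as VAny
open import Data.Vec.Relation.Unary.All using ([]; _∷_)
open import Data.Vec.Relation.Unary.AllPairs using ([]; _∷_)
open import Data.Vec.Relation.Unary.Linked using ([-]; _∷_)
open import Function.Base using (_∘_)
open import Induction.WellFounded using (Acc; acc)
open import Relation.Binary.Definitions using (tri<; tri≈; tri>)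
open import Relation.Binary.PropositionalEquality using (_≢_; refl; sym; trans; cong; subst; ≢-sym)
open import Relation.Nullary.Decidable using (Dec; yes; no; ¬?; _×-dec_; decidable-stable)
open import Relation.Nullary.Negation using (¬_; contradiction)
open import Relation.Unary using (Decidable)

-- Mex and parity

-- Split off from mex-unique because a with-abstraction of leastMissing xs would
-- normalise its search.
least-unique : ∀ {l m} (xs : List ℕ) → l ∉ˡ xs → (∀ {j} → j < l → j ∈ˡ xs) →
  m ∉ˡ xs → (∀ {j} → j < m → j ∈ˡ xs) → l ≡ m
least-unique {l} {m} _ l∉ belowₗ m∉ belowₘ with ℕ.<-cmp l m
... | tri< l<m _ _ = contradiction (belowₘ l<m) l∉
... | tri≈ _ l≡m _ = l≡m
... | tri> _ _ m<l = contradiction (belowₗ m<l) m∉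

mex-unique : ∀ {m} xs → m ∉ˡ xs → (∀ {j} → j < m → j ∈ˡ xs) → mex xs ≡ m
mex-unique xs = least-unique xs (proj₁ (proj₂ (leastMissing xs))) (proj₂ (proj₂ (leastMissing xs)))

suc-%2 : ∀ n → suc n % 2 ≡ 1 ∸ n % 2
suc-%2 zero          = refl
suc-%2 (suc zero)    = refl
suc-%2 (suc (suc n)) = suc-%2 n

%2-cases : ∀ n → n % 2 ≡ 0 ⊎ n % 2 ≡ 1
%2-cases zero          = inj₁ refl
%2-cases (suc zero)    = inj₂ refl
%2-cases (suc (suc n)) = %2-cases n

-- The lists and values are abstract here, so that matching on membership proofs
-- never unfolds nimAt.
module _ {A : Set} (f : A → ℕ) (xs : List A) where

  -- A value `f x` equal to `b` would give `b ≡ 1 ∸ b`, impossible for 0 and 1. If `b` is 1, every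
  -- value is 0, so a single element supplies all that lies below `b`. An empty list has mex 0,
  -- hence nonemptiness is asked only for `b ≡ 1`.
  mex-complement : ∀ {b} → b ≡ 0 ⊎ b ≡ 1 → (∀ {x} → x ∈ˡ xs → b ≡ 1 ∸ f x) →
    (b ≡ 1 → ∃[ x ] x ∈ˡ xs) → mex (map f xs) ≡ b
  mex-complement {b} b≤1 complement nonempty =
    mex-unique (map f xs) (b∉ b≤1) (λ j<b → below b≤1 j<b)
    where
    b∉ : b ≡ 0 ⊎ b ≡ 1 → b ∉ˡ map f xs
    b∉ b≤1 b∈ with ∈-map⁻ f b∈
    b∉ (inj₁ refl) _ | x , x∈ , 0≡fx with trans (complement x∈) (cong (1 ∸_) (sym 0≡fx))
    ... | ()
    b∉ (inj₂ refl) _ | x , x∈ , 1≡fx with trans (complement x∈) (cong (1 ∸_) (sym 1≡fx))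
    ... | ()

    1≡1∸n⇒n≡0 : ∀ n → 1 ≡ 1 ∸ n → n ≡ 0
    1≡1∸n⇒n≡0 zero          _ = refl
    1≡1∸n⇒n≡0 (suc zero)    ()
    1≡1∸n⇒n≡0 (suc (suc n)) ()

    below : b ≡ 0 ⊎ b ≡ 1 → ∀ {j} → j < b → j ∈ˡ map f xs
    below (inj₁ refl) ()
    below (inj₂ refl) (s≤s z≤n) with nonempty refl
    ... | x , x∈ = subst (_∈ˡ map f xs) (1≡1∸n⇒n≡0 (f x) (complement x∈)) (∈-map⁺ f x∈)

module _ (𝒢 : ImpartialGame) where
  open ImpartialGame 𝒢

  -- Well-founded induction: all options have the parity opposite to that of `p`. The rank `ρ` may
  -- be positive at a terminal position as long as it is even there.
  nimAt-parity : (ρ : Position → ℕ) →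
    (∀ {p q} → q ∈ˡ options p → ρ p ≡ suc (ρ q)) →
    (∀ p → ρ p % 2 ≡ 1 → ∃[ q ] q ∈ˡ options p) →
    ∀ p → nimAt 𝒢 p ≡ ρ p % 2
  nimAt-parity ρ ρ-step odd⇒option p = go p (wellFounded p)
    where
    go : ∀ p → Acc (λ q p → q ∈ˡ options p) p → nimAt 𝒢 p ≡ ρ p % 2
    go p (acc rec) = trans (nimAt-mex 𝒢 p)
      (mex-complement (nimAt 𝒢) (options p) (%2-cases (ρ p))
        (λ {q} q∈ → trans (cong (_% 2) (ρ-step q∈))
          (trans (suc-%2 (ρ q)) (cong (1 ∸_) (sym (go q (rec q∈))))))
        (odd⇒option p))

-- Complements and options

∣∁p∣≡1+∣∁[p∪⁅x⁆]∣ : ∀ {n} (p : Subset n) {x} → x ∉ p → ∣ ∁ p ∣ ≡ suc ∣ ∁ (p ∪ ⁅ x ⁆) ∣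
∣∁p∣≡1+∣∁[p∪⁅x⁆]∣ (inside  ∷ p) {zero}  x∉p = contradiction here x∉p
∣∁p∣≡1+∣∁[p∪⁅x⁆]∣ (outside ∷ p) {zero}  x∉p = cong (suc ∘ ∣_∣ ∘ ∁) (sym (∪-identityʳ p))
∣∁p∣≡1+∣∁[p∪⁅x⁆]∣ (inside  ∷ p) {suc x} x∉p = ∣∁p∣≡1+∣∁[p∪⁅x⁆]∣ p (x∉p ∘ there)
∣∁p∣≡1+∣∁[p∪⁅x⁆]∣ (outside ∷ p) {suc x} x∉p = cong suc (∣∁p∣≡1+∣∁[p∪⁅x⁆]∣ p (x∉p ∘ there))

x∈∁[p∪⁅y⁆] : ∀ {n} {p : Subset n} {x y} → x ∈ ∁ p → x ≢ y → x ∈ ∁ (p ∪ ⁅ y ⁆)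
x∈∁[p∪⁅y⁆] {p = p} {y = y} x∈∁p x≢y = x∉p⇒x∈∁p λ x∈ →
  [ x∈∁p⇒x∉p x∈∁p , x≢y ∘ x∈⁅y⁆⇒x≡y y ] (x∈p∪q⁻ p ⁅ y ⁆ x∈)

-- Adding `x` and then `y` to `p` lowers the size of the complement by one each time and leaves
-- nothing outside.
∁-pair⇒∣∁p∣≡2 : ∀ {n} {p : Subset n} {x y} → x ∈ ∁ p → y ∈ ∁ p → x ≢ y →
  (∀ z → z ∈ ∁ p → z ≡ x ⊎ z ≡ y) → ∣ ∁ p ∣ ≡ 2
∁-pair⇒∣∁p∣≡2 {n} {p} {x} {y} x∈ y∈ x≢y only =
  trans (∣∁p∣≡1+∣∁[p∪⁅x⁆]∣ p (x∈∁p⇒x∉p x∈))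
  (cong suc (trans (∣∁p∣≡1+∣∁[p∪⁅x⁆]∣ (p ∪ ⁅ x ⁆) (x∈∁p⇒x∉p (x∈∁[p∪⁅y⁆] y∈ (≢-sym x≢y))))
  (cong suc (trans (cong ∣_∣ (⊆-antisym none (λ z∈ → contradiction z∈ ∉⊥))) (∣⊥∣≡0 n)))))
  where
  none : ∁ ((p ∪ ⁅ x ⁆) ∪ ⁅ y ⁆) ⊆ ∅
  none {z} z∈ = contradiction z∈ (x∈p⇒x∉∁p (covered (z ∈? p)))
    where
    covered : Dec (z ∈ p) → z ∈ (p ∪ ⁅ x ⁆) ∪ ⁅ y ⁆
    covered (yes z∈p) = p⊆p∪q ⁅ y ⁆ (p⊆p∪q ⁅ x ⁆ z∈p)
    covered (no z∉p) with only z (x∉p⇒x∈∁p z∉p)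
    ... | inj₁ refl = p⊆p∪q ⁅ y ⁆ (q⊆p∪q p ⁅ x ⁆ (x∈⁅x⁆ x))
    ... | inj₂ refl = q⊆p∪q (p ∪ ⁅ x ⁆) ⁅ y ⁆ (x∈⁅x⁆ y)

module _ {n : ℕ} (G : Graph n) where
  open ImpartialGame (DNT G) using (options)

  options-shrink-complement : ∀ {P Q} → Q ∈ˡ options P →
    ∣ ∁ (proj₁ P) ∣ ≡ suc ∣ ∁ (proj₁ Q) ∣
  options-shrink-complement {P , _} Q∈ with ∈-mapMaybe⁻ (move G P) (allFin n) Q∈
  ... | v , eq with map-dec⇒maybe⁻ (position G P v) (move? G P v) eq
  ...   | (v∉P , _) , refl = ∣∁p∣≡1+∣∁[p∪⁅x⁆]∣ P v∉P

  option-exists : ∀ P {v} → v ∉ proj₁ P → hull G (∁ (proj₁ P ∪ ⁅ v ⁆)) ≡ ⊤ →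
    ∃[ Q ] Q ∈ˡ options P
  option-exists (P , _) {v} v∉P generating = map₂ (λ {Q} eq →
      Any.mapMaybe⁺ (move G P) (allFin n) (Any.map⁺ (Any.map
        (λ { refl → subst (MAny.Any (Q ≡_)) (sym eq) (MAny.just refl) }) (∈-allFin v))))
    move-defined
    where
    -- `Q` stays existential because a position carries the proof of its legality, here whichever
    -- one `move?` finds.
    move-defined : ∃[ Q ] move G P v ≡ just Q
    move-defined with move? G P v
    ... | yes legal = position G P v legal , refl
    ... | no ¬legal = contradiction (v∉P , generating) ¬legal

-- Vertices and parts

vertex : ∀ {k} (m : Vec ℕ k) j → Fin (lookup m j) → Fin (sum m)
vertex (m₁ ∷ m) zero    a = a ↑ˡ sum m
vertex (m₁ ∷ m) (suc j) a = m₁ ↑ʳ vertex m j a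

vertex-injective : ∀ {k} (m : Vec ℕ k) j {a b} → vertex m j a ≡ vertex m j b → a ≡ b
vertex-injective (m₁ ∷ m) zero    eq = Fin.↑ˡ-injective (sum m) _ _ eq
vertex-injective (m₁ ∷ m) (suc j) eq = vertex-injective m j (Fin.↑ʳ-injective m₁ _ _ eq)

part-vertex : ∀ {k} (m : Vec ℕ k) j a → part m (vertex m j a) ≡ j
part-vertex (m₁ ∷ m) zero    a rewrite Fin.splitAt-↑ˡ m₁ a (sum m) = refl
part-vertex (m₁ ∷ m) (suc j) a rewrite Fin.splitAt-↑ʳ m₁ (sum m) (vertex m j a) =
  cong suc (part-vertex m j a)

module _ {A : Set} {P : A → Set} (P? : Decidable P) where

  count≥1⇒∃ : ∀ {k} (xs : Vec A k) → 1 ≤ count P? xs → ∃[ j ] P (lookup xs j)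
  count≥1⇒∃ (x ∷ xs) 1≤ with P? x
  ... | yes Px = zero , Px
  ... | no  _  with count≥1⇒∃ xs 1≤
  ...   | j , Pj = suc j , Pj

  count≥2⇒∃≢ : ∀ {k} (xs : Vec A k) → 2 ≤ count P? xs → ∀ i → ∃[ j ] j ≢ i × P (lookup xs j)
  count≥2⇒∃≢ (x ∷ xs) 2≤ i with P? x
  count≥2⇒∃≢ (x ∷ xs) (s≤s 1≤) zero | yes _ with count≥1⇒∃ xs 1≤
  ... | j , Pj = suc j , (λ ()) , Pj
  count≥2⇒∃≢ (x ∷ xs) _ (suc i) | yes Px = zero , (λ ()) , Px
  count≥2⇒∃≢ (x ∷ xs) 2≤ zero | no _ with count≥1⇒∃ xs (ℕ.<⇒≤ 2≤)
  ... | j , Pj = suc j , (λ ()) , Pj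
  count≥2⇒∃≢ (x ∷ xs) 2≤ (suc i) | no _ with count≥2⇒∃≢ xs 2≤ i
  ... | j , j≢i , Pj = suc j , j≢i ∘ Fin.suc-injective , Pj

distinct-elements : ∀ {n} → 2 ≤ n → ∃[ a ] ∃[ b ] _≢_ {A = Fin n} a b
distinct-elements (s≤s (s≤s z≤n)) = zero , suc zero , λ ()

-- Twins and convexity

module _ {k} (m : Vec ℕ k) where
  private
    G = completeMultipartite m

  Twins : Fin (sum m) → Fin (sum m) → Set
  Twins u v = u ≢ v × part m u ≡ part m v

  HasTwins : Subset (sum m) → Set
  HasTwins S = ∃[ u ] ∃[ v ] (u ∈ S × v ∈ S × Twins u v)

  hasTwins? : ∀ S → Dec (HasTwins S)
  hasTwins? S = Fin.any? λ u → Fin.any? λ v → (u ∈? S) ×-dec (v ∈? S) ×-dec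
    ¬? (u Fin.≟ v) ×-dec (part m u Fin.≟ part m v)

  another-twins : 2 ≤ count (2 ≤?_) m → ∀ i → ∃[ x ] ∃[ y ] (part m x ≢ i × Twins x y)
  another-twins λ≥2 i with count≥2⇒∃≢ (2 ≤?_) m λ≥2 i
  ... | j , j≢i , 2≤ with distinct-elements 2≤
  ...   | a , b , a≢b =
    vertex m j a , vertex m j b , subst (_≢ i) (sym (part-vertex m j a)) j≢i ,
    a≢b ∘ vertex-injective m j , trans (part-vertex m j a) (sym (part-vertex m j b))

  -- No edge would identify the ends, and a single edge would join two vertices of one part.
  twins-path-length : ∀ {u v} → Twins u v → ∀ {ℓ} (p : Vec (Fin (sum m)) (suc ℓ)) →
    IsPath G u v p → 2 ≤ ℓ
  twins-path-length (u≢v , _) (x ∷ []) (refl , refl , _) = contradiction refl u≢v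
  twins-path-length (_ , same) (x ∷ y ∷ []) (refl , refl , adj ∷ _ , _) = contradiction same adj
  twins-path-length _ (x ∷ y ∷ z ∷ p) _ = s≤s (s≤s z≤n)

  -- The path `u`, `w`, `v` has two edges, and no path between twins is shorter, so convexity
  -- captures `w`.
  twins-dominate : ∀ {K u v} → Convex G K → u ∈ K → v ∈ K → Twins u v →
    ∀ {w} → part m w ≢ part m u → w ∈ K
  twins-dominate {K} {u} {v} conv u∈ v∈ uv@(u≢v , same) {w} w≢ =
    conv u∈ v∈ (u ∷ w ∷ v ∷ [])
      ( ( refl , refl , ≢-sym w≢ ∷ w≢v ∷ [-]
        , ((w≢ ∘ cong (part m) ∘ sym) ∷ u≢v ∷ []) ∷ ((w≢v ∘ cong (part m)) ∷ []) ∷ [] ∷ [])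
      , twins-path-length uv)
      w (VAny.there (VAny.here refl))
    where
    w≢v : part m w ≢ part m v
    w≢v = w≢ ∘ (λ eq → trans eq (sym same))

  twins-generate : 2 ≤ count (2 ≤?_) m → ∀ {S} → HasTwins S → hull G S ≡ ⊤
  twins-generate λ≥2 {S} (u , v , u∈ , v∈ , uv) = ⊆-antisym (⊆-max _) λ {w} _ →
    ∈-hull⁺ G (λ K conv S⊆K → everything conv (S⊆K u∈) (S⊆K v∈) w)
    where
    everything : ∀ {K} → Convex G K → u ∈ K → v ∈ K → ∀ w → w ∈ K
    everything conv u∈K v∈K w with part m w Fin.≟ part m u
    ... | no  w≢u = twins-dominate conv u∈K v∈K uv w≢u
    -- The part of `u` is reached by going back: `x` and `y` lie in another part, hence in `K`, and
    -- as twins they dominate `w`.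
    ... | yes w≡u with another-twins λ≥2 (part m u)
    ...   | x , y , x≢u , xy@(_ , same) = twins-dominate conv
      (twins-dominate conv u∈K v∈K uv x≢u)
      (twins-dominate conv u∈K v∈K uv (x≢u ∘ trans same))
      xy (λ w≡x → x≢u (trans (sym w≡x) w≡u))

  -- Distinct members of a twin-free set are adjacent, so a shortest path between members has at
  -- most one edge and consists of its ends alone.
  twin-free-convex : ∀ {S} → ¬ HasTwins S → Convex G S
  twin-free-convex _ u∈ _ (x ∷ []) ((refl , _) , _) _ (VAny.here refl) = u∈
  twin-free-convex _ u∈ _ (x ∷ y ∷ []) ((refl , _) , _) _ (VAny.here refl) = u∈
  twin-free-convex _ _ v∈ (x ∷ y ∷ []) ((_ , refl , _) , _) _ (VAny.there (VAny.here refl)) = v∈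
  -- Two or more edges are beaten by the trivial path if `u` and `v` coincide, and by the edge
  -- between them otherwise.
  twin-free-convex ¬twins {u} {v} u∈ v∈ (x ∷ y ∷ z ∷ p) (_ , shortest) _ _ with u Fin.≟ v
  ... | yes refl = contradiction (shortest (u ∷ []) (refl , refl , [-] , [] ∷ [])) λ ()
  ... | no  u≢v  = contradiction
    (shortest (u ∷ v ∷ []) (refl , refl , adj ∷ [-] , (u≢v ∷ []) ∷ [] ∷ []))
    λ { (s≤s ()) }
    where
    adj : part m u ≢ part m v
    adj same = ¬twins (u , v , u∈ , v∈ , u≢v , same)

  -- A twin-free `S` is its own hull, so it would be all of `⊤`, which does contain twins.
  generating⇒twins : 2 ≤ count (2 ≤?_) m → ∀ {S} → hull G S ≡ ⊤ → HasTwins S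
  generating⇒twins λ≥2 {S} generating = decidable-stable (hasTwins? S) λ ¬twins →
    -- `another-twins` asks for a part to avoid; the positive count provides an index.
    let i , _ = count≥1⇒∃ (2 ≤?_) m (ℕ.<⇒≤ λ≥2)
        x , y , _ , xy = another-twins λ≥2 i
        all : ∀ {w} → w ∈ S
        all = hull-least G S S (twin-free-convex ¬twins) (λ z → z) (subst (_ ∈_) (sym generating) ∈⊤)
    in ¬twins (x , y , all , all , xy)

  -- The complement contains twins, and being odd it has a third vertex `w`. Selecting `w` keeps the
  -- twins outside, so the move is legal.
  odd⇒option : 2 ≤ count (2 ≤?_) m → ∀ P → ∣ ∁ (proj₁ P) ∣ % 2 ≡ 1 →
    ∃[ Q ] Q ∈ˡ ImpartialGame.options (DNT G) P
  odd⇒option λ≥2 P@(P′ , generating) odd with generating⇒twins λ≥2 generating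
  ... | u , v , u∈ , v∈ , uv@(u≢v , _)
      with Fin.any? (λ w → (w ∈? ∁ P′) ×-dec ¬? (w Fin.≟ u) ×-dec ¬? (w Fin.≟ v))
  ...   | yes (w , w∈ , w≢u , w≢v) = option-exists G P (x∈∁p⇒x∉p w∈)
    (twins-generate λ≥2 (u , v , x∈∁[p∪⁅y⁆] u∈ (≢-sym w≢u) , x∈∁[p∪⁅y⁆] v∈ (≢-sym w≢v) , uv))
  ...   | no ∄w = contradiction
    (trans (sym (cong (_% 2) (∁-pair⇒∣∁p∣≡2 u∈ v∈ u≢v only))) odd) λ ()
    where
    only : ∀ z → z ∈ ∁ P′ → z ≡ u ⊎ z ≡ v
    only z z∈ with z Fin.≟ u | z Fin.≟ v
    ... | yes z≡u | _       = inj₁ z≡u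
    ... | no _    | yes z≡v = inj₂ z≡v
    ... | no z≢u  | no z≢v  = contradiction (z , z∈ , z≢u , z≢v) ∄w

proposition5p10 : ∀ {k-1 : ℕ} (m : Vec ℕ (suc k-1)) →
    2 ≤ suc k-1 → All (1 ≤_) m → Linked _≤_ m → 2 ≤ last m →
    2 ≤ count (2 ≤?_) m →
    nim (DNT (completeMultipartite m)) ≡ pty {sum m} ⊤
proposition5p10 m _ _ _ _ λ≥2 = trans
  -- The rank is the size of the complement: the number of remaining moves plus two, which has the
  -- same parity.
  (nimAt-parity (DNT G) (λ P → ∣ ∁ (proj₁ P) ∣)
    (λ {P Q} → options-shrink-complement G {P} {Q})
    (odd⇒option m λ≥2) (ImpartialGame.start (DNT G)))
  -- At the starting position the complement is the whole vertex set.
  (cong (pty {sum m}) (⊆-antisym (⊆-max (∁ ∅)) (λ _ → x∉p⇒x∈∁p ∉⊥)))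
  where
  G = completeMultipartite m
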